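{- For every positive integer $n$ there exists a bijection $\phi : DC(n) \rightarrow \mathfrak{D}_{n+1}'$ such that $$st(\phi(C)) = \binom{n}{2} - \mathrm{inv}(C)$$ for all $C \in DC(n)$.
   Context: Dellac configurations. A Dellac configuration of size $n$ is a placement of $2n$ dots in the cells of a grid with $n$ columns (indexed $1,\dots,n$ from left to right) and $2n$ rows (indexed $1,\dots,2n$ from bottom to top) such that each row contains exactly one dot, each column contains exactly two dots, and every dot lying in column $j$ and row $i$ satisfies $j \le i \le j+n$ (i.e. the dots lie between the lines $y=x$ and $y=x+n$). Let $DC(n)$ be the set of these. An inversion of $C\in DC(n)$ is a pair of dots with (column,row) coordinates $(j_1,i_1)$ and $(j_2,i_2)$ such that $j_1<j_2$ and $i_1>i_2$; $\mathrm{inv}(C)$ is the number of inversions. Dumont permutations. $\mathfrak{S}_m$ is the set of permutations of $[m]=\{1,\dots,m\}$. A Dumont permutation of order $2m$ is $\sigma\in\mathfrak{S}_{2m}$ with $\sigma(2i)<2i$ and $\sigma(2i-1)>2i-1$ for all $i\in[m]$; $\mathfrak{D}_m$ denotes their set. A normalized Dumont permutation of order $2m$ is $\sigma\in\mathfrak{D}_m$ such that for every $j\in[m-1]$, the integers $\sigma^{ -1}(2j)$ and $\sigma^{ -1}(2j+1)$ have the same parity if and only if $\sigma^{ -1}(2j)>\sigma^{ -1}(2j+1)$; $\mathfrak{D}_m'$ denotes their set. For a word $w=l_1\cdots l_r$ of integers, $\mathrm{inv}(w)$ is the number of pairs $a<b$ with $l_a>l_b$. For $\sigma\in\mathfrak{D}_m$,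 let $\sigma^o=\sigma(1)\sigma(3)\cdots\sigma(2m-1)$, $\sigma^e=\sigma(2)\sigma(4)\cdots\sigma(2m)$ and $$st(\sigma)=m^2-\sum_{i=1}^m\sigma(2i)-\mathrm{inv}(\sigma^o)-\mathrm{inv}(\sigma^e).$$ -}

module Defs where

open import Data.Nat using (ℕ; zero; suc; _+_; _*_; _≤_; _<_; _>_; _<?_; _≟_; _%_)
open import Data.Nat.Combinatorics using (_C_)
open import Data.Integer as ℤ using (ℤ; +_)
open import Data.Fin using (Fin; toℕ)
open import Data.List using (List; []; _∷_; length; filter)
open import Data.Nat.ListAction using (sum)
open import Data.Vec using (Vec; lookup; toList; count)
open import Data.Product using (_×_)
open import Function.Bundles using (_⇔_)
open import Relation.Binary.Bundles using (Setoid)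
open import Relation.Binary.PropositionalEquality using (_≡_)
import Relation.Binary.PropositionalEquality as PE
import Relation.Binary.Construct.On as On

inv : List ℕ → ℕ
inv []       = 0
inv (x ∷ xs) = length (filter (_<? x) xs) + inv xs

oddPos evenPos : {A : Set} → List A → List A
oddPos []       = []
oddPos (x ∷ xs) = x ∷ evenPos xs
evenPos []       = []
evenPos (x ∷ xs) = oddPos xs

-- Dellac configurations of size n.
-- Row r (1-indexed, r = 1 + toℕ i for i : Fin (2n)) contains exactly one dot,
-- in column  lookup col i  (1-indexed).  So "one dot per row" is built in.
record DC (n : ℕ) : Set where
  field
    col      : Vec ℕ (2 * n)
    colRange : ∀ (i : Fin (2 * n)) → 1 ≤ lookup col i × lookup col i ≤ n
    between  : ∀ (i : Fin (2 * n)) →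
               lookup col i ≤ suc (toℕ i) × suc (toℕ i) ≤ lookup col i + n
    twoDots  : ∀ (j : ℕ) → 1 ≤ j → j ≤ n → count (j ≟_) col ≡ 2
open DC public

-- inversions of C: pairs of dots (j₁,i₁),(j₂,i₂) with j₁ < j₂ and i₁ > i₂,
-- i.e. pairs of rows r < r' whose columns satisfy col r > col r'.
invDC : {n : ℕ} → DC n → ℕ
invDC C = inv (toList (col C))

-- Permutations of [2m] in one-line notation σ(1)⋯σ(2m)
-- (position p = 1 + toℕ i for i : Fin (2m)).
record Dumont (m : ℕ) : Set where
  field
    σ        : Vec ℕ (2 * m)
    valRange : ∀ (i : Fin (2 * m)) → 1 ≤ lookup σ i × lookup σ i ≤ 2 * m
    isPerm   : ∀ (k : ℕ) → 1 ≤ k → k ≤ 2 * m → count (k ≟_) σ ≡ 1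
    evenDesc : ∀ (i : Fin (2 * m)) → suc (toℕ i) % 2 ≡ 0 → lookup σ i < suc (toℕ i)
    oddAsc   : ∀ (i : Fin (2 * m)) → suc (toℕ i) % 2 ≡ 1 → lookup σ i > suc (toℕ i)
open Dumont public

record NormDumont (m : ℕ) : Set where
  field
    dumont     : Dumont m
    normalized : ∀ (j : ℕ) → 1 ≤ j → j < m →
                 ∀ (p q : Fin (2 * m)) →
                 lookup (σ dumont) p ≡ 2 * j →
                 lookup (σ dumont) q ≡ suc (2 * j) →
                 (suc (toℕ p) % 2 ≡ suc (toℕ q) % 2) ⇔ (toℕ q < toℕ p)
open NormDumont public

st : {m : ℕ} → Dumont m → ℤ
st {m} D =
  ((+ (m * m) ℤ.- + sum (evenPos w)) ℤ.- + inv (oddPos w)) ℤ.- + inv (evenPos w)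
  where w = toList (σ D)

-- Setoids: two elements are equal iff their underlying arrays are equal
-- (the remaining fields are properties).
DC-setoid : ℕ → Setoid _ _
DC-setoid n = On.setoid {B = DC n} (PE.setoid (Vec ℕ (2 * n))) col

NormDumont-setoid : ℕ → Setoid _ _
NormDumont-setoid m =
  On.setoid {B = NormDumont m} (PE.setoid (Vec ℕ (2 * m))) (λ D → σ (dumont D))

{-# OPTIONS --safe #-}
module Submission where

-- Relabel the two dots of each column j, read from bottom to top, by 2j+1 and then 2j. The
-- labels of rows 1..n and n+1..2n form words b and a such that ba is a permutation of
-- {2,…,2n+1}; put σ^e = 1 b and σ^o = a (2n+2). The Dellac condition on row i becomes the
-- Dumont condition at one position of σ, and "2j+1 before 2j in ba" is the normalization.
-- Relabelling adds one inversion per column, so inv(C) + n = inv(b) + inv(a) + cross(b,a),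
-- where cross(u,v) counts the pairs (x,y) ∈ u × v with x > y. Each x in b exceeds exactly
-- x - 2 letters of ba, so cross(b,b) + cross(b,a) = Σb - 2n, while cross(b,b) = C(n,2)
-- because the letters of b are distinct. Eliminating cross(b,a) gives the formula for st(σ).

open import Defs
open import Data.Nat
open import Data.Bool using (true; false; if_then_else_)
open import Data.Fin as Fin using (toℕ)
import Data.Integer as ℤ
import Data.Integer.Tactic.RingSolver as ℤ-Solver
open import Data.List
  using (List; []; _∷_; [_]; _++_; _∷ʳ_; length; filter; map; take; drop; initLast; _∷ʳ′_)
open import Data.List.Membership.DecPropositional _≟_ using (_∈_; _∉_; _∈?_)
open import Data.List.Membership.Propositional.Properties
  using (∈-map⁻; ∈-map⁺; ∈-++⁺ˡ; ∈-++⁺ʳ; ∈-++⁻)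
open import Data.List.Properties
  using (length-++; length-map; length-take; length-drop; take++drop≡id; ∷-injectiveʳ; ∷ʳ-injectiveˡ)
open import Data.List.Relation.Unary.Any using (here; there)
open import Data.Nat.Combinatorics using (_C_; nC1≡n; nCk+nC[k+1]≡[n+1]C[k+1])
open import Data.Nat.DivMod using ([m+kn]%n≡m%n; m*n%n≡0)
open import Data.Nat.ListAction using (sum)
open import Data.Nat.Properties
open import Data.Nat.Tactic.RingSolver using (solve-∀)
open import Data.Product using (Σ; _×_; _,_; proj₁; proj₂; ∃-syntax)
open import Data.Sum using (_⊎_; inj₁; inj₂)
open import Data.Vec as Vec using (Vec; lookup; toList; fromList; count)
open import Data.Vec.Properties as Vec using (toList∘fromList)
open import Function using (_∘_; _⇔_; mk⇔)
open import Function.Bundles using (Bijection; Equivalence)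
open import Level using (0ℓ)
open import Relation.Binary.Definitions using (tri<; tri≈; tri>)
open import Relation.Binary.PropositionalEquality hiding ([_])
open import Relation.Nullary using (Dec; yes; no; does; ¬_; contradiction)
open import Relation.Unary using (Pred; Decidable)

-- Indicators and counts of list entries.

ι : {P : Set} → Dec P → ℕ
ι P? = if does P? then 1 else 0

ι-yes : {P : Set} (P? : Dec P) → P → ι P? ≡ 1
ι-yes (yes _) _ = refl
ι-yes (no ¬p) p = contradiction p ¬p

ι-no : {P : Set} (P? : Dec P) → ¬ P → ι P? ≡ 0
ι-no (yes p) ¬p = contradiction p ¬p
ι-no (no _)  _  = refl

ι-⇔ : {P Q : Set} (P? : Dec P) (Q? : Dec Q) → (P → Q) → (Q → P) → ι P? ≡ ι Q?
ι-⇔ (yes p) Q? f g = sym (ι-yes Q? (f p))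
ι-⇔ (no ¬p) Q? f g = sym (ι-no Q? (¬p ∘ g))

ι-suc : ∀ x k → ι (x <? suc k) ≡ ι (x <? k) + ι (k ≟ x)
ι-suc x k with <-cmp x k
... | tri< x<k x≢k _ = trans (ι-yes (x <? suc k) (m<n⇒m<1+n x<k))
                             (sym (cong₂ _+_ (ι-yes (x <? k) x<k) (ι-no (k ≟ x) (x≢k ∘ sym))))
... | tri≈ x≮k refl _ = trans (ι-yes (x <? suc x) (n<1+n x))
                             (sym (cong₂ _+_ (ι-no (x <? x) x≮k) (ι-yes (x ≟ x) refl)))
... | tri> x≮k x≢k k<x = trans (ι-no (x <? suc k) (<⇒≱ k<x ∘ s≤s⁻¹))
                             (sym (cong₂ _+_ (ι-no (x <? k) x≮k) (ι-no (k ≟ x) (x≢k ∘ sym))))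

tally : {P : Pred ℕ 0ℓ} → Decidable P → List ℕ → ℕ
tally P? xs = length (filter P? xs)

tally-∷ : {P : Pred ℕ 0ℓ} (P? : Decidable P) (x : ℕ) (xs : List ℕ) →
          tally P? (x ∷ xs) ≡ ι (P? x) + tally P? xs
tally-∷ P? x xs with does (P? x)
... | true  = refl
... | false = refl

tally-++ : {P : Pred ℕ 0ℓ} (P? : Decidable P) (xs ys : List ℕ) →
           tally P? (xs ++ ys) ≡ tally P? xs + tally P? ys
tally-++ P? []       ys = refl
tally-++ P? (x ∷ xs) ys = begin
  tally P? (x ∷ xs ++ ys)                  ≡⟨ tally-∷ P? x (xs ++ ys) ⟩
  ι (P? x) + tally P? (xs ++ ys)           ≡⟨ cong (ι (P? x) +_) (tally-++ P? xs ys) ⟩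
  ι (P? x) + (tally P? xs + tally P? ys)   ≡⟨ +-assoc (ι (P? x)) _ _ ⟨
  ι (P? x) + tally P? xs + tally P? ys     ≡⟨ cong (_+ tally P? ys) (tally-∷ P? x xs) ⟨
  tally P? (x ∷ xs) + tally P? ys          ∎
  where open ≡-Reasoning

tally-none : {P : Pred ℕ 0ℓ} (P? : Decidable P) (xs : List ℕ) →
             (∀ {x} → x ∈ xs → ¬ P x) → tally P? xs ≡ 0
tally-none P? []       h = refl
tally-none P? (x ∷ xs) h = trans (tally-∷ P? x xs)
  (cong₂ _+_ (ι-no (P? x) (h (here refl))) (tally-none P? xs (h ∘ there)))

tally-all : {P : Pred ℕ 0ℓ} (P? : Decidable P) (xs : List ℕ) →
            (∀ {x} → x ∈ xs → P x) → tally P? xs ≡ length xs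
tally-all P? []       h = refl
tally-all P? (x ∷ xs) h = trans (tally-∷ P? x xs)
  (cong₂ _+_ (ι-yes (P? x) (h (here refl))) (tally-all P? xs (h ∘ there)))

mult : ℕ → List ℕ → ℕ
mult k = tally (k ≟_)

below : ℕ → List ℕ → ℕ
below k = tally (_<? k)

private
  interchange : ∀ a b c d → (a + b) + (c + d) ≡ (a + c) + (b + d)
  interchange = solve-∀

below-suc : ∀ k xs → below (suc k) xs ≡ below k xs + mult k xs
below-suc k []       = refl
below-suc k (x ∷ xs) = begin
  below (suc k) (x ∷ xs)                                   ≡⟨ tally-∷ (_<? suc k) x xs ⟩
  ι (x <? suc k) + below (suc k) xs                        ≡⟨ cong₂ _+_ (ι-suc x k) (below-suc k xs) ⟩
  (ι (x <? k) + ι (k ≟ x)) + (below k xs + mult k xs)      ≡⟨ interchange (ι (x <? k)) _ _ _ ⟩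
  (ι (x <? k) + below k xs) + (ι (k ≟ x) + mult k xs)      ≡⟨ cong₂ _+_ (tally-∷ (_<? k) x xs) (tally-∷ (k ≟_) x xs) ⟨
  below k (x ∷ xs) + mult k (x ∷ xs)                       ∎
  where open ≡-Reasoning

-- Raising the threshold by one adds the multiplicity of the old threshold, which is 1 throughout
-- the interval, and nothing lies below `m`. With `m` = 2 this gives the ranks in `b ++ a`, with `m`
-- = 1 the length of `repeats`.
below-interval : ∀ m d xs → (∀ {x} → x ∈ xs → m ≤ x) →
                 (∀ k → m ≤ k → k < d + m → mult k xs ≡ 1) → below (d + m) xs ≡ d
below-interval m zero    xs lo one = tally-none (_<? m) xs (λ x∈ x<m → <⇒≱ x<m (lo x∈))
below-interval m (suc d) xs lo one = begin
  below (suc d + m) xs                 ≡⟨ below-suc (d + m) xs ⟩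
  below (d + m) xs + mult (d + m) xs   ≡⟨ cong₂ _+_ (below-interval m d xs lo (λ k m≤k → one k m≤k ∘ m<n⇒m<1+n))
                                                    (one (d + m) (m≤n+m m d) (n<1+n _)) ⟩
  d + 1                                ≡⟨ +-comm d 1 ⟩
  suc d                                ∎
  where open ≡-Reasoning

mult-∉ : ∀ {k} xs → k ∉ xs → mult k xs ≡ 0
mult-∉ {k} xs k∉ = tally-none (k ≟_) xs (λ { x∈ refl → k∉ x∈ })

mult-≢ : ∀ {k x} xs → k ≢ x → mult k (x ∷ xs) ≡ mult k xs
mult-≢ {k} {x} xs k≢x = trans (tally-∷ (k ≟_) x xs) (cong (_+ mult k xs) (ι-no (k ≟ x) k≢x))

mult-≡ : ∀ k xs → mult k (k ∷ xs) ≡ suc (mult k xs)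
mult-≡ k xs = trans (tally-∷ (k ≟_) k xs) (cong (_+ mult k xs) (ι-yes (k ≟ k) refl))

mult-∷-≤ : ∀ k x xs → mult k xs ≤ mult k (x ∷ xs)
mult-∷-≤ k x xs = ≤-trans (m≤n+m _ (ι (k ≟ x))) (≤-reflexive (sym (tally-∷ (k ≟_) x xs)))

mult-∈ : ∀ {k} {xs} → k ∈ xs → 1 ≤ mult k xs
mult-∈ {k} {x ∷ xs} (here refl) = ≤-trans (s≤s z≤n) (≤-reflexive (sym (mult-≡ k xs)))
mult-∈ {k} {x ∷ xs} (there k∈)  = ≤-trans (mult-∈ k∈) (mult-∷-≤ k x xs)

∈-mult : ∀ {k} xs → 1 ≤ mult k xs → k ∈ xs
∈-mult {k} xs 1≤ with k ∈? xs
... | yes k∈ = k∈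
... | no  k∉ = contradiction 1≤ (<⇒≱ (s≤s (≤-reflexive (mult-∉ xs k∉))))

-- Halving, and the relabelling of the occurrences of a value.

half : ℕ → ℕ
half = ⌊_/2⌋

half-even : ∀ j → half (j * 2) ≡ j
half-even zero    = refl
half-even (suc j) = cong suc (half-even j)

half-odd : ∀ j → half (suc (j * 2)) ≡ j
half-odd zero    = refl
half-odd (suc j) = cong suc (half-odd j)

even-or-odd : ∀ x → x ≡ half x * 2 ⊎ x ≡ suc (half x * 2)
even-or-odd zero          = inj₁ refl
even-or-odd (suc zero)    = inj₂ refl
even-or-odd (suc (suc x)) with even-or-odd x
... | inj₁ eq = inj₁ (cong (suc ∘ suc) eq)
... | inj₂ eq = inj₂ (cong (suc ∘ suc) eq)

m*2≢1+n*2 : ∀ j k → j * 2 ≢ suc (k * 2)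
m*2≢1+n*2 (suc j) (suc k) eq = m*2≢1+n*2 j k (suc-injective (suc-injective eq))

-- When j occurs exactly twice, its first occurrence becomes 2j+1 and its second 2j.
label : List ℕ → List ℕ
label []       = []
label (x ∷ xs) = ι (x ∈? xs) + x * 2 ∷ label xs

-- These are the entries that receive an odd label: all occurrences of a value but its last. Their
-- number is what relabelling adds to the inversion number.
repeats : List ℕ → List ℕ
repeats []       = []
repeats (x ∷ xs) with x ∈? xs
... | yes _ = x ∷ repeats xs
... | no _  = repeats xs

repeats-⊆ : ∀ {y} xs → y ∈ repeats xs → y ∈ xs
repeats-⊆ (x ∷ xs) y∈ with x ∈? xs
repeats-⊆ (x ∷ xs) (here eq)  | yes _ = here eq
repeats-⊆ (x ∷ xs) (there y∈) | yes _ = there (repeats-⊆ xs y∈)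
repeats-⊆ (x ∷ xs) y∈         | no _  = there (repeats-⊆ xs y∈)

mult-repeats : ∀ k xs → mult k (repeats xs) ≡ mult k xs ∸ 1
mult-repeats k []       = refl
mult-repeats k (x ∷ xs) with x ∈? xs | k ≟ x
... | yes x∈ | yes refl = begin
  mult k (k ∷ repeats xs)    ≡⟨ mult-≡ k (repeats xs) ⟩
  suc (mult k (repeats xs))  ≡⟨ cong suc (mult-repeats k xs) ⟩
  suc (mult k xs ∸ 1)        ≡⟨ m+[n∸m]≡n (mult-∈ x∈) ⟩
  mult k xs                  ≡⟨ cong (_∸ 1) (mult-≡ k xs) ⟨
  mult k (k ∷ xs) ∸ 1        ∎
  where open ≡-Reasoning
... | yes x∈ | no k≢x = trans (mult-≢ (repeats xs) k≢x)
                          (trans (mult-repeats k xs) (cong (_∸ 1) (sym (mult-≢ xs k≢x))))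
... | no x∉  | yes refl = begin
  mult k (repeats xs)    ≡⟨ mult-∉ (repeats xs) (x∉ ∘ repeats-⊆ xs) ⟩
  0                      ≡⟨ mult-∉ xs x∉ ⟨
  mult k xs              ≡⟨ cong (_∸ 1) (mult-≡ k xs) ⟨
  mult k (k ∷ xs) ∸ 1    ∎
  where open ≡-Reasoning
... | no x∉  | no k≢x = trans (mult-repeats k xs) (cong (_∸ 1) (sym (mult-≢ xs k≢x)))

half-label : ∀ xs → map half (label xs) ≡ xs
half-label []       = refl
half-label (x ∷ xs) with x ∈? xs
... | yes _ = cong₂ _∷_ (half-odd x) (half-label xs)
... | no _  = cong₂ _∷_ (half-even x) (half-label xs)

length-label : ∀ xs → length (label xs) ≡ length xs
length-label xs = trans (sym (length-map half (label xs))) (cong length (half-label xs))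

-- Only the last occurrence of `j` is labelled `j * 2`, so the minimum with 1 records whether `j`
-- occurs at all.
mult-label-even : ∀ j xs → mult (j * 2) (label xs) ≡ mult j xs ⊓ 1
mult-label-even j []       = refl
mult-label-even j (x ∷ xs) with x ∈? xs | j ≟ x
... | yes x∈ | yes refl = begin
  mult (j * 2) (suc (j * 2) ∷ label xs) ≡⟨ mult-≢ (label xs) (m*2≢1+n*2 j j) ⟩
  mult (j * 2) (label xs)               ≡⟨ mult-label-even j xs ⟩
  mult j xs ⊓ 1                         ≡⟨ m≥n⇒m⊓n≡n (mult-∈ x∈) ⟩
  1                                     ≡⟨ m≥n⇒m⊓n≡n (s≤s z≤n) ⟨
  suc (mult j xs) ⊓ 1                   ≡⟨ cong (_⊓ 1) (mult-≡ j xs) ⟨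
  mult j (j ∷ xs) ⊓ 1                   ∎
  where open ≡-Reasoning
... | no x∉ | yes refl = begin
  mult (j * 2) (j * 2 ∷ label xs)       ≡⟨ mult-≡ (j * 2) (label xs) ⟩
  suc (mult (j * 2) (label xs))         ≡⟨ cong suc (mult-label-even j xs) ⟩
  suc (mult j xs ⊓ 1)                   ≡⟨ cong (λ m → suc (m ⊓ 1)) (mult-∉ xs x∉) ⟩
  1                                     ≡⟨ cong (λ m → suc m ⊓ 1) (mult-∉ xs x∉) ⟨
  suc (mult j xs) ⊓ 1                   ≡⟨ cong (_⊓ 1) (mult-≡ j xs) ⟨
  mult j (j ∷ xs) ⊓ 1                   ∎
  where open ≡-Reasoning
... | yes _ | no j≢x = trans (mult-≢ (label xs) (m*2≢1+n*2 j x))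
                         (trans (mult-label-even j xs) (cong (_⊓ 1) (sym (mult-≢ xs j≢x))))
... | no _ | no j≢x = trans (mult-≢ (label xs) (j≢x ∘ *-cancelʳ-≡ j x 2))
                         (trans (mult-label-even j xs) (cong (_⊓ 1) (sym (mult-≢ xs j≢x))))

-- The preimages of `j` under `half` are exactly `j * 2` and its successor.
mult-half : ∀ j xs → mult j (map half xs) ≡ mult (j * 2) xs + mult (suc (j * 2)) xs
mult-half j []       = refl
mult-half j (x ∷ xs) = begin
  mult j (half x ∷ map half xs)
    ≡⟨ tally-∷ (j ≟_) (half x) (map half xs) ⟩
  ι (j ≟ half x) + mult j (map half xs)
    ≡⟨ cong₂ _+_ ι-half (mult-half j xs) ⟩
  (ι (j * 2 ≟ x) + ι (suc (j * 2) ≟ x)) + (mult (j * 2) xs + mult (suc (j * 2)) xs)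
    ≡⟨ interchange (ι (j * 2 ≟ x)) _ _ _ ⟩
  (ι (j * 2 ≟ x) + mult (j * 2) xs) + (ι (suc (j * 2) ≟ x) + mult (suc (j * 2)) xs)
    ≡⟨ cong₂ _+_ (tally-∷ (j * 2 ≟_) x xs) (tally-∷ (suc (j * 2) ≟_) x xs) ⟨
  mult (j * 2) (x ∷ xs) + mult (suc (j * 2)) (x ∷ xs) ∎
  where
  open ≡-Reasoning
  ι-half : ι (j ≟ half x) ≡ ι (j * 2 ≟ x) + ι (suc (j * 2) ≟ x)
  ι-half with even-or-odd x
  ... | inj₁ eq = begin
    ι (j ≟ half x)                              ≡⟨ ι-⇔ (j ≟ half x) (j * 2 ≟ x) (λ { refl → sym eq })
                                                     (λ { refl → sym (half-even j) }) ⟩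
    ι (j * 2 ≟ x)                               ≡⟨ +-identityʳ _ ⟨
    ι (j * 2 ≟ x) + 0                           ≡⟨ cong (ι (j * 2 ≟ x) +_) (ι-no (suc (j * 2) ≟ x)
                                                     (λ e → m*2≢1+n*2 (half x) j (trans (sym eq) (sym e)))) ⟨
    ι (j * 2 ≟ x) + ι (suc (j * 2) ≟ x)         ∎
  ... | inj₂ eq = begin
    ι (j ≟ half x)                              ≡⟨ ι-⇔ (j ≟ half x) (suc (j * 2) ≟ x) (λ { refl → sym eq })
                                                     (λ { refl → sym (half-odd j) }) ⟩
    ι (suc (j * 2) ≟ x)                         ≡⟨ cong (_+ ι (suc (j * 2) ≟ x)) (ι-no (j * 2 ≟ x)
                                                     (λ e → m*2≢1+n*2 j (half x) (trans e eq))) ⟨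
    ι (j * 2 ≟ x) + ι (suc (j * 2) ≟ x)         ∎

-- By complement: halving the labels restores the word, so the even and odd labels of `j` together
-- number `mult j xs`, and the even ones are already counted.
mult-label-odd : ∀ j xs → mult (suc (j * 2)) (label xs) ≡ mult j xs ∸ 1
mult-label-odd j xs = +-cancelˡ-≡ (mult j xs ⊓ 1) _ _ (begin
  mult j xs ⊓ 1 + mult (suc (j * 2)) (label xs)
    ≡⟨ cong (_+ mult (suc (j * 2)) (label xs)) (mult-label-even j xs) ⟨
  mult (j * 2) (label xs) + mult (suc (j * 2)) (label xs)
    ≡⟨ mult-half j (label xs) ⟨
  mult j (map half (label xs))
    ≡⟨ cong (mult j) (half-label xs) ⟩
  mult j xs
    ≡⟨ split (mult j xs) ⟩
  mult j xs ⊓ 1 + (mult j xs ∸ 1) ∎)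
  where
  open ≡-Reasoning
  split : ∀ m → m ≡ m ⊓ 1 + (m ∸ 1)
  split zero    = refl
  split (suc m) = cong (λ k → suc (k + m)) (sym (⊓-zeroʳ m))

-- Both possible labels of `x`, namely `x * 2` and its successor, lie below `k * 2` exactly when
-- `x < k`.
below-label : ∀ k xs → below (k * 2) (label xs) ≡ below k xs
below-label k []       = refl
below-label k (x ∷ xs) = begin
  below (k * 2) (label (x ∷ xs))                       ≡⟨ tally-∷ (_<? k * 2) (ι (x ∈? xs) + x * 2) (label xs) ⟩
  ι (ι (x ∈? xs) + x * 2 <? k * 2) + below (k * 2) (label xs)
    ≡⟨ cong₂ _+_ (ι-⇔ (ι (x ∈? xs) + x * 2 <? k * 2) (x <? k) to from) (below-label k xs) ⟩
  ι (x <? k) + below k xs                              ≡⟨ tally-∷ (_<? k) x xs ⟨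
  below k (x ∷ xs)                                     ∎
  where
  open ≡-Reasoning
  to : ι (x ∈? xs) + x * 2 < k * 2 → x < k
  to lt = *-cancelʳ-< 2 x k (≤-<-trans (m≤n+m (x * 2) _) lt)
  from : x < k → ι (x ∈? xs) + x * 2 < k * 2
  from lt = ≤-trans (s≤s (+-monoˡ-≤ (x * 2) (ι≤1 (x ∈? xs)))) (*-monoˡ-≤ 2 lt)
    where
    ι≤1 : {P : Set} (P? : Dec P) → ι P? ≤ 1
    ι≤1 (yes _) = ≤-refl
    ι≤1 (no _)  = z≤n

-- An even label `x * 2` has as many smaller letters to its right as `x` had. An odd label
-- `suc (x * 2)` exceeds in addition the single later `x * 2`, so each entry of `repeats` costs one
-- inversion.
inv-label : ∀ xs → inv (label xs) ≡ inv xs + length (repeats xs)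
inv-label []       = refl
inv-label (x ∷ xs) with x ∈? xs
... | no _ = trans (cong₂ _+_ (below-label x xs) (inv-label xs)) (sym (+-assoc (below x xs) _ _))
... | yes x∈ = begin
  below (suc (x * 2)) (label xs) + inv (label xs)
    ≡⟨ cong (_+ inv (label xs)) (below-suc (x * 2) (label xs)) ⟩
  (below (x * 2) (label xs) + mult (x * 2) (label xs)) + inv (label xs)
    ≡⟨ cong₂ _+_ (cong₂ _+_ (below-label x xs)
                            (trans (mult-label-even x xs) (m≥n⇒m⊓n≡n (mult-∈ x∈))))
                 (inv-label xs) ⟩
  (below x xs + 1) + (inv xs + length (repeats xs))
    ≡⟨ shift (below x xs) (inv xs) _ ⟩
  (below x xs + inv xs) + suc (length (repeats xs)) ∎
  where
  open ≡-Reasoning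
  shift : ∀ a b c → (a + 1) + (b + c) ≡ (a + b) + suc c
  shift = solve-∀

-- Inversions between two words.

cross : List ℕ → List ℕ → ℕ
cross xs ys = sum (map (λ x → below x ys) xs)

inv-++ : ∀ xs ys → inv (xs ++ ys) ≡ inv xs + inv ys + cross xs ys
inv-++ []       ys = sym (+-identityʳ _)
inv-++ (x ∷ xs) ys = trans (cong₂ _+_ (tally-++ (_<? x) xs ys) (inv-++ xs ys))
                           (shuffle (below x xs) _ (inv xs) (inv ys) _)
  where
  shuffle : ∀ a b c d e → (a + b) + (c + d + e) ≡ (a + c) + d + (b + e)
  shuffle = solve-∀

cross-++ : ∀ xs ys zs → cross xs (ys ++ zs) ≡ cross xs ys + cross xs zs
cross-++ []       ys zs = refl
cross-++ (x ∷ xs) ys zs = trans (cong₂ _+_ (tally-++ (_<? x) ys zs) (cross-++ xs ys zs))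
                                (interchange (below x ys) _ _ _)

-- `cross` recurses on its first word. Counting the same pairs by letters of the second word makes
-- it possible to peel the head off both words in `cross-self`.
cross-∷ : ∀ xs y ys → cross xs (y ∷ ys) ≡ tally (y <?_) xs + cross xs ys
cross-∷ []       y ys = refl
cross-∷ (x ∷ xs) y ys = begin
  below x (y ∷ ys) + cross xs (y ∷ ys)                            ≡⟨ cong₂ _+_ (tally-∷ (_<? x) y ys) (cross-∷ xs y ys) ⟩
  (ι (y <? x) + below x ys) + (tally (y <?_) xs + cross xs ys)    ≡⟨ interchange (ι (y <? x)) _ _ _ ⟩
  (ι (y <? x) + tally (y <?_) xs) + (below x ys + cross xs ys)    ≡⟨ cong (_+ cross (x ∷ xs) ys) (tally-∷ (y <?_) x xs) ⟨
  tally (y <?_) (x ∷ xs) + cross (x ∷ xs) ys                      ∎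
  where open ≡-Reasoning

below+above : ∀ x ys → x ∉ ys → below x ys + tally (x <?_) ys ≡ length ys
below+above x []       x∉ = refl
below+above x (y ∷ ys) x∉ = begin
  below x (y ∷ ys) + tally (x <?_) (y ∷ ys)                       ≡⟨ cong₂ _+_ (tally-∷ (_<? x) y ys) (tally-∷ (x <?_) y ys) ⟩
  (ι (y <? x) + below x ys) + (ι (x <? y) + tally (x <?_) ys)     ≡⟨ interchange (ι (y <? x)) _ _ _ ⟩
  (ι (y <? x) + ι (x <? y)) + (below x ys + tally (x <?_) ys)     ≡⟨ cong₂ _+_ compare′ (below+above x ys (x∉ ∘ there)) ⟩
  suc (length ys)                                                 ∎
  where
  open ≡-Reasoning
  compare′ : ι (y <? x) + ι (x <? y) ≡ 1
  compare′ with <-cmp x y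
  ... | tri< x<y _ y≮x = cong₂ _+_ (ι-no (y <? x) y≮x) (ι-yes (x <? y) x<y)
  ... | tri≈ _ x≡y _   = contradiction (here x≡y) x∉
  ... | tri> x≮y _ y<x = cong₂ _+_ (ι-yes (y <? x) y<x) (ι-no (x <? y) x≮y)

-- Of two distinct letters exactly one exceeds the other, so the head contributes one for each
-- remaining letter, whether smaller or larger. Pascal's rule adds up these contributions.
cross-self : ∀ xs → (∀ k → mult k xs ≤ 1) → cross xs xs ≡ length xs C 2
cross-self []       distinct = refl
cross-self (x ∷ xs) distinct = begin
  below x (x ∷ xs) + cross xs (x ∷ xs)
    ≡⟨ cong₂ _+_ (trans (tally-∷ (_<? x) x xs) (cong (_+ below x xs) (ι-no (x <? x) (<-irrefl refl)))) (cross-∷ xs x xs) ⟩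
  below x xs + (tally (x <?_) xs + cross xs xs)
    ≡⟨ +-assoc (below x xs) _ _ ⟨
  (below x xs + tally (x <?_) xs) + cross xs xs
    ≡⟨ cong₂ _+_ (below+above x xs x∉) (cross-self xs (λ k → ≤-trans (mult-∷-≤ k x xs) (distinct k))) ⟩
  length xs + length xs C 2
    ≡⟨ cong (_+ length xs C 2) (nC1≡n (length xs)) ⟨
  length xs C 1 + length xs C 2
    ≡⟨ nCk+nC[k+1]≡[n+1]C[k+1] (length xs) 1 ⟩
  suc (length xs) C 2 ∎
  where
  open ≡-Reasoning
  x∉ : x ∉ xs
  x∉ x∈ = <⇒≱ (s≤s (mult-∈ x∈)) (≤-trans (≤-reflexive (sym (mult-≡ x xs))) (distinct x))

cross-ranks : ∀ xs ys → (∀ {x} → x ∈ xs → below x ys + 2 ≡ x) → cross xs ys + length xs * 2 ≡ sum xs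
cross-ranks []       ys rank = refl
cross-ranks (x ∷ xs) ys rank = begin
  (below x ys + cross xs ys) + (2 + length xs * 2)    ≡⟨ interchange (below x ys) _ _ _ ⟩
  (below x ys + 2) + (cross xs ys + length xs * 2)    ≡⟨ cong₂ _+_ (rank (here refl)) (cross-ranks xs ys (rank ∘ there)) ⟩
  x + sum xs                                          ∎
  where open ≡-Reasoning

nC2-double : ∀ n → n C 2 + n C 2 + n ≡ n * n
nC2-double zero    = refl
nC2-double (suc n) = begin
  suc n C 2 + suc n C 2 + suc n                   ≡⟨ cong (λ c → c + c + suc n) pascal ⟨
  (n + n C 2) + (n + n C 2) + suc n               ≡⟨ regroup n (n C 2) ⟩
  (n C 2 + n C 2 + n) + suc (n + n)               ≡⟨ cong (_+ suc (n + n)) (nC2-double n) ⟩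
  n * n + suc (n + n)                             ≡⟨ square n ⟩
  suc n * suc n                                   ∎
  where
  open ≡-Reasoning
  pascal : n + n C 2 ≡ suc n C 2
  pascal = trans (cong (_+ n C 2) (sym (nC1≡n n))) (nCk+nC[k+1]≡[n+1]C[k+1] n 1)
  regroup : ∀ n c → (n + c) + (n + c) + suc n ≡ (c + c + n) + suc (n + n)
  regroup = solve-∀
  square : ∀ n → n * n + suc (n + n) ≡ suc n * suc n
  square = solve-∀

-- Positions in lists.

infix 4 _[_]=_

-- Positions are natural numbers, so that positions in different words can be compared by
-- arithmetic. The value in `here` is given by an equation, so that matching also works for values
-- such as `j * 2`.
data _[_]=_ : List ℕ → ℕ → ℕ → Set where
  here  : ∀ {x y xs} → x ≡ y → x ∷ xs [ 0 ]= y
  there : ∀ {x y xs i} → xs [ i ]= y → x ∷ xs [ suc i ]= y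

[]=⇒∈ : ∀ {xs i x} → xs [ i ]= x → x ∈ xs
[]=⇒∈ (here eq)  = here (sym eq)
[]=⇒∈ (there at) = there ([]=⇒∈ at)

∈⇒[]= : ∀ {x xs} → x ∈ xs → ∃[ i ] xs [ i ]= x
∈⇒[]= (here eq)  = 0 , here (sym eq)
∈⇒[]= (there x∈) with i , at ← ∈⇒[]= x∈ = suc i , there at

[]=⇒< : ∀ {xs i x} → xs [ i ]= x → i < length xs
[]=⇒< (here _)   = s≤s z≤n
[]=⇒< (there at) = s≤s ([]=⇒< at)

[]=-++ˡ : ∀ {xs ys i x} → xs [ i ]= x → xs ++ ys [ i ]= x
[]=-++ˡ (here eq)  = here eq
[]=-++ˡ (there at) = there ([]=-++ˡ at)

[]=-++ʳ : ∀ xs {ys i x} → ys [ i ]= x → xs ++ ys [ length xs + i ]= x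
[]=-++ʳ []       at = at
[]=-++ʳ (_ ∷ xs) at = there ([]=-++ʳ xs at)

[]=-++⁻ : ∀ xs {ys i x} → xs ++ ys [ i ]= x →
          xs [ i ]= x ⊎ ∃[ k ] i ≡ length xs + k × ys [ k ]= x
[]=-++⁻ []       at         = inj₂ (_ , refl , at)
[]=-++⁻ (_ ∷ xs) (here eq)  = inj₁ (here eq)
[]=-++⁻ (_ ∷ xs) (there at) with []=-++⁻ xs at
... | inj₁ at′              = inj₁ (there at′)
... | inj₂ (k , refl , at′) = inj₂ (k , refl , at′)

[]=-map : ∀ (f : ℕ → ℕ) {xs i x} → xs [ i ]= x → map f xs [ i ]= f x
[]=-map f (here eq)  = here (cong f eq)
[]=-map f (there at) = there ([]=-map f at)

[]=-map⁻ : ∀ (f : ℕ → ℕ) xs {i y} → map f xs [ i ]= y → ∃[ x ] xs [ i ]= x × f x ≡ y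
[]=-map⁻ f (x ∷ xs) (here eq)  = x , here refl , eq
[]=-map⁻ f (x ∷ xs) (there at) with z , at′ , eq ← []=-map⁻ f xs at = z , there at′ , eq

-- Interleaving two words.

weave : List ℕ → List ℕ → List ℕ
weave (x ∷ xs) (y ∷ ys) = x ∷ y ∷ weave xs ys
weave _        _        = []

length-weave : ∀ xs ys → length xs ≡ length ys → length (weave xs ys) ≡ length xs * 2
length-weave []       []       _  = refl
length-weave (x ∷ xs) (y ∷ ys) eq = cong (2 +_) (length-weave xs ys (suc-injective eq))

oddPos-weave : ∀ xs ys → length xs ≡ length ys → oddPos (weave xs ys) ≡ xs
oddPos-weave []       []       _  = refl
oddPos-weave (x ∷ xs) (y ∷ ys) eq = cong (x ∷_) (oddPos-weave xs ys (suc-injective eq))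

evenPos-weave : ∀ xs ys → length xs ≡ length ys → evenPos (weave xs ys) ≡ ys
evenPos-weave []       []       _  = refl
evenPos-weave (x ∷ xs) (y ∷ ys) eq = cong (y ∷_) (evenPos-weave xs ys (suc-injective eq))

unweave : ∀ k zs → length zs ≡ k * 2 →
          ∃[ xs ] ∃[ ys ] length xs ≡ k × length ys ≡ k × zs ≡ weave xs ys
unweave zero    []           _  = [] , [] , refl , refl , refl
unweave (suc k) (x ∷ y ∷ zs) eq
  with xs , ys , refl , ys≡k , refl ← unweave k zs (suc-injective (suc-injective eq)) =
  x ∷ xs , y ∷ ys , refl , cong suc ys≡k , refl

mult-weave : ∀ k xs ys → length xs ≡ length ys → mult k (weave xs ys) ≡ mult k xs + mult k ys
mult-weave k []       []       _  = refl
mult-weave k (x ∷ xs) (y ∷ ys) eq = begin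
  mult k (x ∷ y ∷ weave xs ys)                              ≡⟨ tally-∷ (k ≟_) x _ ⟩
  ι (k ≟ x) + mult k (y ∷ weave xs ys)                      ≡⟨ cong (ι (k ≟ x) +_) (tally-∷ (k ≟_) y _) ⟩
  ι (k ≟ x) + (ι (k ≟ y) + mult k (weave xs ys))            ≡⟨ cong (λ m → ι (k ≟ x) + (ι (k ≟ y) + m))
                                                                    (mult-weave k xs ys (suc-injective eq)) ⟩
  ι (k ≟ x) + (ι (k ≟ y) + (mult k xs + mult k ys))         ≡⟨ regroup (ι (k ≟ x)) (ι (k ≟ y)) (mult k xs) (mult k ys) ⟩
  (ι (k ≟ x) + mult k xs) + (ι (k ≟ y) + mult k ys)         ≡⟨ cong₂ _+_ (tally-∷ (k ≟_) x xs) (tally-∷ (k ≟_) y ys) ⟨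
  mult k (x ∷ xs) + mult k (y ∷ ys)                         ∎
  where
  open ≡-Reasoning
  regroup : ∀ a b c d → a + (b + (c + d)) ≡ (a + c) + (b + d)
  regroup = solve-∀

[]=-weaveˡ : ∀ {xs ys} → length xs ≡ length ys → ∀ {i x} → xs [ i ]= x → weave xs ys [ i * 2 ]= x
[]=-weaveˡ {_ ∷ _} {_ ∷ _} eq (here e)   = here e
[]=-weaveˡ {_ ∷ _} {_ ∷ _} eq (there at) = there (there ([]=-weaveˡ (suc-injective eq) at))

[]=-weaveʳ : ∀ {xs ys} → length xs ≡ length ys → ∀ {i y} → ys [ i ]= y → weave xs ys [ suc (i * 2) ]= y
[]=-weaveʳ {_ ∷ _} {_ ∷ _} eq (here e)   = there (here e)
[]=-weaveʳ {_ ∷ _} {_ ∷ _} eq (there at) = there (there ([]=-weaveʳ (suc-injective eq) at))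

[]=-weave⁻ : ∀ xs ys {p z} → weave xs ys [ p ]= z →
             (∃[ i ] p ≡ i * 2 × xs [ i ]= z) ⊎ (∃[ i ] p ≡ suc (i * 2) × ys [ i ]= z)
[]=-weave⁻ (x ∷ xs) (y ∷ ys) (here e)           = inj₁ (0 , refl , here e)
[]=-weave⁻ (x ∷ xs) (y ∷ ys) (there (here e))   = inj₂ (0 , refl , here e)
[]=-weave⁻ (x ∷ xs) (y ∷ ys) (there (there at)) with []=-weave⁻ xs ys at
... | inj₁ (i , refl , at′) = inj₁ (suc i , refl , there at′)
... | inj₂ (i , refl , at′) = inj₂ (suc i , refl , there at′)

-- Characterization of the words that arise by relabelling.

Ordered : List ℕ → Set
Ordered xs = ∀ j {s t} → xs [ s ]= j * 2 → xs [ t ]= suc (j * 2) → t < s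

label-[]= : ∀ xs {i x} → label xs [ i ]= x → xs [ i ]= half x
label-[]= xs at = subst (_[ _ ]= _) (half-label xs) ([]=-map half at)

label-ordered : ∀ xs → Ordered (label xs)
label-ordered (x ∷ xs) j (here e)  (here e′)  = contradiction (trans (sym e) e′) (m*2≢1+n*2 j j)
label-ordered (x ∷ xs) j (there _) (here _)   = s≤s z≤n
label-ordered (x ∷ xs) j (there p) (there q)  = s≤s (label-ordered xs j p q)
-- The forbidden order: an even label at the head means that `x` does not recur, yet a later
-- `suc (j * 2)` would come from another occurrence of `x`.
label-ordered (x ∷ xs) j (here e)  (there q) with x ∈? xs
... | yes _ = contradiction (sym e) (m*2≢1+n*2 j x)
... | no x∉ = contradiction ([]=⇒∈ (subst (xs [ _ ]=_) half≡x (label-[]= xs q))) x∉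
  where
  half≡x : half (suc (j * 2)) ≡ x
  half≡x = trans (half-odd j) (sym (*-cancelʳ-≡ x j 2 e))

-- It must be shown that a letter is odd exactly when its half recurs further right. An odd letter
-- has an even partner by closure, and the order condition puts it to the right. An even letter can
-- have no letter of equal half to its right, by distinctness and order.
label-half : ∀ xs → Ordered xs → (∀ k → mult k xs ≤ 1) →
             (∀ j → suc (j * 2) ∈ xs → j * 2 ∈ xs) → label (map half xs) ≡ xs
label-half []       ordered distinct closed = refl
label-half (x ∷ xs) ordered distinct closed = cong₂ _∷_ head tail
  where
  ordered′ : Ordered xs
  ordered′ j p q = s≤s⁻¹ (ordered j (there p) (there q))

  closed′ : ∀ j → suc (j * 2) ∈ xs → j * 2 ∈ xs
  closed′ j o∈ with closed j (there o∈)
  ... | there e∈ = e∈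
  -- The partner cannot be the head, since it would then precede `suc (j * 2)`.
  ... | here e   with _ , q ← ∈⇒[]= o∈ = contradiction (ordered j (here (sym e)) (there q)) λ ()

  tail : label (map half xs) ≡ xs
  tail = label-half xs ordered′ (λ k → ≤-trans (mult-∷-≤ k x xs) (distinct k)) closed′

  x∉ : x ∉ xs
  x∉ x∈ = <⇒≱ (s≤s (mult-∈ x∈)) (≤-trans (≤-reflexive (sym (mult-≡ x xs))) (distinct x))

  head : ι (half x ∈? map half xs) + half x * 2 ≡ x
  head with half x ∈? map half xs | even-or-odd x
  ... | no _   | inj₁ e = sym e
  ... | yes _  | inj₂ e = sym e
  -- An odd head has its even partner in the tail, so its half does recur.
  ... | no h∉  | inj₂ e with closed (half x) (here (sym e))
  ...   | here e′  = contradiction (trans e′ e) (m*2≢1+n*2 (half x) (half x))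
  ...   | there e∈ = contradiction (subst (_∈ map half xs) (half-even (half x)) (∈-map⁺ half e∈)) h∉
  -- A later letter with the same half as an even head either equals the head or is the odd partner
  -- on the wrong side.
  head | yes h∈ | inj₁ e with y , y∈ , eq ← ∈-map⁻ half h∈ | even-or-odd y
  ...   | inj₁ e′ = contradiction (subst (_∈ xs) (trans e′ (trans (cong (_* 2) (sym eq)) (sym e))) y∈) x∉
  ...   | inj₂ e′ with _ , q ← ∈⇒[]= y∈ =
    contradiction (ordered (half x) (here e)
                   (there (subst (xs [ _ ]=_) (trans e′ (cong (λ h → suc (h * 2)) (sym eq))) q))) λ ()

-- Configurations, labellings and normalized Dumont permutations as predicates on plain lists.

record IsDellac (n : ℕ) (c : List ℕ) : Set where
  field
    size  : length c ≡ 2 * n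
    cell  : ∀ {i x} → c [ i ]= x → (1 ≤ x × x ≤ n) × (x ≤ suc i × suc i ≤ x + n)
    twice : ∀ j → 1 ≤ j → j ≤ n → mult j c ≡ 2

-- b and a hold the labels of rows 1..n and n+1..2n of a configuration; for the Dumont
-- permutation they are σ(4)σ(6)⋯σ(2n+2) and σ(1)σ(3)⋯σ(2n-1).
record IsLabelling (n : ℕ) (b a : List ℕ) : Set where
  field
    size-b  : length b ≡ n
    size-a  : length a ≡ n
    -- Row i+1 allows columns up to i+1, hence labels up to 2(i+1)+1; equally, this letter stands at
    -- position 2i+4 of σ and must be smaller. In `bound-a`, row n+i+1 requires columns from i+1 on,
    -- hence labels from 2i+2 on; equally, that letter stands at position 2i+1 and must be larger.
    bound-b : ∀ {i x} → b [ i ]= x → 2 ≤ x × x ≤ 3 + i * 2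
    bound-a : ∀ {i x} → a [ i ]= x → 2 + i * 2 ≤ x × x ≤ 1 + n * 2
    once    : ∀ k → 2 ≤ k → k ≤ 1 + n * 2 → mult k (b ++ a) ≡ 1
    ordered : Ordered (b ++ a)

  bound : ∀ {x} → x ∈ b ++ a → 2 ≤ x × x ≤ 1 + n * 2
  bound x∈ with ∈-++⁻ b x∈
  ... | inj₁ x∈b with i , at ← ∈⇒[]= x∈b with 2≤x , x≤ ← bound-b at =
    2≤x , ≤-trans x≤ (s≤s (*-monoˡ-≤ 2 (subst (i <_) size-b ([]=⇒< at))))
  ... | inj₂ x∈a with i , at ← ∈⇒[]= x∈a with ≤x , x≤ ← bound-a at =
    ≤-trans (s≤s (s≤s z≤n)) ≤x , x≤

  distinct : ∀ k → mult k (b ++ a) ≤ 1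
  distinct k with k ∈? b ++ a
  ... | yes k∈ with 2≤k , k≤ ← bound k∈ = ≤-reflexive (once k 2≤k k≤)
  ... | no k∉ = ≤-trans (≤-reflexive (mult-∉ _ k∉)) z≤n

-- Indices start at 0, so that σ(2i+2) stands at index suc (i * 2) and σ(2i+1) at i * 2.
record IsNormDumont (m : ℕ) (w : List ℕ) : Set where
  field
    size       : length w ≡ m * 2
    range      : ∀ {i x} → w [ i ]= x → 1 ≤ x × x ≤ m * 2
    once       : ∀ k → 1 ≤ k → k ≤ m * 2 → mult k w ≡ 1
    even-below : ∀ {i x} → w [ suc (i * 2) ]= x → x < suc (suc (i * 2))
    odd-above  : ∀ {i x} → w [ i * 2 ]= x → x > suc (i * 2)
    normal     : ∀ j → 1 ≤ j → j < m → ∀ {p q} → w [ p ]= j * 2 → w [ q ]= suc (j * 2) →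
                 (suc p % 2 ≡ suc q % 2) ⇔ q < p

-- From configurations to labellings and back.

half*2≤ : ∀ x → half x * 2 ≤ x
half*2≤ x with even-or-odd x
... | inj₁ e = ≤-reflexive (sym e)
... | inj₂ e = ≤-trans (n≤1+n _) (≤-reflexive (sym e))

≤1+half*2 : ∀ x → x ≤ suc (half x * 2)
≤1+half*2 x with even-or-odd x
... | inj₁ e = ≤-trans (≤-reflexive e) (n≤1+n _)
... | inj₂ e = ≤-reflexive e

label-isLabelling : ∀ {n c} → IsDellac n c → IsLabelling n (take n (label c)) (drop n (label c))
label-isLabelling {n} {c} dc = record
  { size-b  = size-b
  ; size-a  = trans (length-drop n (label c)) (trans (cong (_∸ n) size-L) (m+n∸m≡n n n))
  ; bound-b = bound-b
  ; bound-a = bound-a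
  ; once    = λ k 2≤k k≤ → trans (cong (mult k) split) (once k 2≤k k≤)
  ; ordered = subst Ordered (sym split) (label-ordered c)
  }
  where
  open IsDellac dc
  split : take n (label c) ++ drop n (label c) ≡ label c
  split = take++drop≡id n (label c)

  size-L : length (label c) ≡ n + n
  size-L = trans (length-label c) (trans size (cong (n +_) (+-identityʳ n)))

  size-b : length (take n (label c)) ≡ n
  size-b = trans (length-take n (label c)) (m≤n⇒m⊓n≡m (subst (n ≤_) (sym size-L) (m≤m+n n n)))

  entry : ∀ {i x} → take n (label c) ++ drop n (label c) [ i ]= x → c [ i ]= half x
  entry at = label-[]= c (subst (_[ _ ]= _) split at)

  bound-b : ∀ {i x} → take n (label c) [ i ]= x → 2 ≤ x × x ≤ 3 + i * 2
  bound-b {i} {x} at with (1≤h , _) , (h≤ , _) ← cell (entry ([]=-++ˡ at)) =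
    ≤-trans (*-monoˡ-≤ 2 1≤h) (half*2≤ x) , ≤-trans (≤1+half*2 x) (s≤s (*-monoˡ-≤ 2 h≤))

  bound-a : ∀ {i x} → drop n (label c) [ i ]= x → 2 + i * 2 ≤ x × x ≤ 1 + n * 2
  bound-a {i} {x} at with (_ , h≤n) , (_ , ≤h) ← cell (entry ([]=-++ʳ (take n (label c)) at)) =
    ≤-trans (*-monoˡ-≤ 2 1+i≤h) (half*2≤ x) , ≤-trans (≤1+half*2 x) (s≤s (*-monoˡ-≤ 2 h≤n))
    where
    1+i≤h : suc i ≤ half x
    -- Entry `i` of the upper word lies in row n+i+1, so `n` cancels against the shift in the line y
    -- = x + n.
    1+i≤h = +-cancelˡ-≤ n _ _ (begin
      n + suc i                              ≡⟨ +-suc n i ⟩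
      suc (n + i)                            ≡⟨ cong (λ m → suc (m + i)) size-b ⟨
      suc (length (take n (label c)) + i)    ≤⟨ ≤h ⟩
      half x + n                             ≡⟨ +-comm (half x) n ⟩
      n + half x                             ∎)
      where open ≤-Reasoning

  once : ∀ k → 2 ≤ k → k ≤ 1 + n * 2 → mult k (label c) ≡ 1
  once k 2≤k k≤ with even-or-odd k | ⌊n/2⌋-mono 2≤k | subst (half k ≤_) (half-odd n) (⌊n/2⌋-mono k≤)
  ... | inj₁ e | 1≤h | h≤n = trans (cong (λ k → mult k (label c)) e)
    (trans (mult-label-even (half k) c) (cong (_⊓ 1) (twice (half k) 1≤h h≤n)))
  ... | inj₂ e | 1≤h | h≤n = trans (cong (λ k → mult k (label c)) e)
    (trans (mult-label-odd (half k) c) (cong (_∸ 1) (twice (half k) 1≤h h≤n)))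

module _ {n : ℕ} {b a : List ℕ} (lab : IsLabelling n b a) where
  open IsLabelling lab

  label-half-labelling : label (map half (b ++ a)) ≡ b ++ a
  label-half-labelling = label-half (b ++ a) ordered distinct closed
    where
    closed : ∀ j → suc (j * 2) ∈ b ++ a → j * 2 ∈ b ++ a
    -- Here `j` = 0 would make 1 a letter, although all letters are at least 2.
    closed zero    o∈ with s≤s () , _ ← bound o∈
    closed (suc j) o∈ with _ , o≤ ← bound o∈ =
      ∈-mult _ (≤-reflexive (sym (once (suc j * 2) (s≤s (s≤s z≤n)) (≤-trans (n≤1+n _) o≤))))

  -- The bound on a label halves to one of the two diagonal conditions. The other holds by position:
  -- rows of `b` are at most `n`, and rows of `a` lie above every column number.
  half-isDellac : IsDellac n (map half (b ++ a))
  half-isDellac = record { size = size ; cell = cell ; twice = twice }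
    where
    size : length (map half (b ++ a)) ≡ 2 * n
    size = trans (length-map half (b ++ a)) (trans (length-++ b)
             (cong₂ _+_ size-b (trans size-a (sym (+-identityʳ n)))))

    cell : ∀ {i h} → map half (b ++ a) [ i ]= h → (1 ≤ h × h ≤ n) × (h ≤ suc i × suc i ≤ h + n)
    cell {i} at with x , at′ , refl ← []=-map⁻ half (b ++ a) at with []=-++⁻ b at′
    ... | inj₁ at-b with 2≤x , x≤ ← bound-b at-b =
      (⌊n/2⌋-mono 2≤x , ≤-trans h≤ i<n) , (h≤ , ≤-trans i<n (m≤n+m n (half x)))
      where
      i<n : i < n
      i<n = subst (i <_) size-b ([]=⇒< at-b)
      h≤ : half x ≤ suc i
      h≤ = subst (half x ≤_) (half-odd (suc i)) (⌊n/2⌋-mono x≤)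
    ... | inj₂ (k , refl , at-a) with ≤x , x≤ ← bound-a at-a rewrite size-b =
      (≤-trans (s≤s z≤n) k<h , h≤n) , (≤-trans h≤n (≤-trans (m≤m+n n k) (n≤1+n _)) ,
       subst (suc (n + k) ≤_) (+-comm n (half x)) (subst (_≤ n + half x) (+-suc n k) (+-monoʳ-≤ n k<h)))
      where
      k<h : suc k ≤ half x
      k<h = subst (_≤ half x) (half-even (suc k)) (⌊n/2⌋-mono ≤x)
      h≤n : half x ≤ n
      h≤n = subst (half x ≤_) (half-odd n) (⌊n/2⌋-mono x≤)

    twice : ∀ j → 1 ≤ j → j ≤ n → mult j (map half (b ++ a)) ≡ 2
    twice j 1≤j j≤n = trans (mult-half j (b ++ a)) (cong₂ _+_
      (once (j * 2) (*-monoˡ-≤ 2 1≤j) (≤-trans (*-monoˡ-≤ 2 j≤n) (n≤1+n _)))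
      (once (suc (j * 2)) (≤-trans (*-monoˡ-≤ 2 1≤j) (n≤1+n _)) (s≤s (*-monoˡ-≤ 2 j≤n))))

-- From labellings to normalized Dumont permutations and back.

word : ℕ → List ℕ → List ℕ → List ℕ
word n b a = weave (a ∷ʳ suc n * 2) (1 ∷ b)

length-∷ʳ : ∀ xs (x : ℕ) → length (xs ∷ʳ x) ≡ suc (length xs)
length-∷ʳ xs x = trans (length-++ xs) (+-comm (length xs) 1)

1+i*2%2 : ∀ i → suc (i * 2) % 2 ≡ 1
1+i*2%2 i = [m+kn]%n≡m%n 1 i 2

2+i*2%2 : ∀ i → suc (suc (i * 2)) % 2 ≡ 0
2+i*2%2 i = m*n%n≡0 (suc i) 2

-- x and y are labels of one column j with a dot in each half; the conclusion places x,
-- at index i * 2 of σ, before y, at index 3 + i′ * 2.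
mixed-≤ : ∀ {i i′ j x y} → 2 + i * 2 ≤ x → x ≤ suc (j * 2) → j * 2 ≤ y → y ≤ 3 + i′ * 2 → i ≤ i′
mixed-≤ {i} {i′} {j} ix xj jy yi′ =
  s≤s⁻¹ (≤-trans (*-cancelʳ-< 2 i j (s≤s⁻¹ (≤-trans ix xj)))
                 (s≤s⁻¹ (*-cancelʳ-< 2 j (2 + i′) (s≤s (≤-trans jy yi′)))))

module _ {n : ℕ} (b a : List ℕ) (size-b : length b ≡ n) (size-a : length a ≡ n) where

  size-oe : length (a ∷ʳ suc n * 2) ≡ length (1 ∷ b)
  size-oe = trans (length-∷ʳ a _) (cong suc (trans size-a (sym size-b)))

  mult-word : ∀ k → mult k (word n b a) ≡ ι (k ≟ 1) + (ι (k ≟ suc n * 2) + mult k (b ++ a))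
  mult-word k = begin
    mult k (word n b a)
      ≡⟨ mult-weave k (a ∷ʳ M) (1 ∷ b) size-oe ⟩
    mult k (a ∷ʳ M) + mult k (1 ∷ b)
      ≡⟨ cong₂ _+_ (trans (tally-++ (k ≟_) a [ M ]) (cong (mult k a +_) (tally-∷ (k ≟_) M []))) (tally-∷ (k ≟_) 1 b) ⟩
    (mult k a + (ι (k ≟ M) + 0)) + (ι (k ≟ 1) + mult k b)
      ≡⟨ regroup (mult k a) (ι (k ≟ M)) (ι (k ≟ 1)) (mult k b) ⟩
    ι (k ≟ 1) + (ι (k ≟ M) + (mult k b + mult k a))
      ≡⟨ cong (λ m → ι (k ≟ 1) + (ι (k ≟ M) + m)) (tally-++ (k ≟_) b a) ⟨
    ι (k ≟ 1) + (ι (k ≟ M) + mult k (b ++ a)) ∎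
    where
    open ≡-Reasoning
    M = suc n * 2
    regroup : ∀ p q r s → (p + (q + 0)) + (r + s) ≡ r + (q + (s + p))
    regroup = solve-∀

  word-a : ∀ {i x} → a [ i ]= x → word n b a [ i * 2 ]= x
  word-a at = []=-weaveˡ size-oe ([]=-++ˡ at)

  word-b : ∀ {i x} → b [ i ]= x → word n b a [ 3 + i * 2 ]= x
  word-b at = []=-weaveʳ size-oe (there at)

  -- Positions and values enter through equations, so that a case split is possible at composite
  -- positions such as `suc (i * 2)`, where the wrong parity is then refuted.
  data Place (p x : ℕ) : Set where
    first : p ≡ 1 → x ≡ 1 → Place p x
    final : p ≡ n * 2 → x ≡ suc n * 2 → Place p x
    in-a  : ∀ i → p ≡ i * 2 → a [ i ]= x → Place p x
    in-b  : ∀ i → p ≡ 3 + i * 2 → b [ i ]= x → Place p x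

  place : ∀ {p x} → word n b a [ p ]= x → Place p x
  place at with []=-weave⁻ (a ∷ʳ suc n * 2) (1 ∷ b) at
  ... | inj₂ (zero , p≡ , here e)     = first p≡ (sym e)
  ... | inj₂ (suc i , p≡ , there at′) = in-b i p≡ at′
  ... | inj₁ (i , p≡ , at′) with []=-++⁻ a at′
  ...   | inj₁ at″ = in-a i p≡ at″
  ...   | inj₂ (zero , refl , here e) =
    final (trans p≡ (cong (_* 2) (trans (+-identityʳ _) size-a))) (sym e)

  once⇒ : (∀ k → 2 ≤ k → k ≤ 1 + n * 2 → mult k (b ++ a) ≡ 1) →
          (∀ {x} → x ∈ b ++ a → 2 ≤ x × x ≤ 1 + n * 2) →
          ∀ k → 1 ≤ k → k ≤ suc n * 2 → mult k (word n b a) ≡ 1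
  once⇒ once bound k 1≤k k≤ = trans (mult-word k) (cases (k ≟ 1) (k ≟ suc n * 2))
    where
    cases : (d : Dec (k ≡ 1)) (e : Dec (k ≡ suc n * 2)) → ι d + (ι e + mult k (b ++ a)) ≡ 1
    cases (yes refl) (yes ())
    cases (yes refl) (no _)  = cong suc (mult-∉ (b ++ a) (λ k∈ → <⇒≱ (s≤s (s≤s z≤n)) (proj₁ (bound k∈))))
    cases (no _) (yes refl)  = cong suc (mult-∉ (b ++ a) (λ k∈ → <⇒≱ (n<1+n _) (proj₂ (bound k∈))))
    cases (no k≢1) (no k≢M)  = once k (≤∧≢⇒< 1≤k (k≢1 ∘ sym)) (s≤s⁻¹ (≤∧≢⇒< k≤ k≢M))

  once⇐ : (∀ k → 1 ≤ k → k ≤ suc n * 2 → mult k (word n b a) ≡ 1) →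
          ∀ k → 2 ≤ k → k ≤ 1 + n * 2 → mult k (b ++ a) ≡ 1
  once⇐ once k 2≤k k≤ = trans
    (sym (trans (mult-word k) (cong₂ _+_ (ι-no (k ≟ 1) λ { refl → <⇒≱ (s≤s (s≤s z≤n)) 2≤k })
                              (cong (_+ mult k (b ++ a)) (ι-no (k ≟ suc n * 2) λ { refl → <⇒≱ (n<1+n _) k≤ })))))
    (once k (≤-trans (n≤1+n 1) 2≤k) (≤-trans k≤ (n≤1+n _)))

-- Letters of `a` occupy odd positions and letters of `b` even ones, each in their own order. Two
-- labels of one column in the same word thus have equal parity, and `Ordered` is the normalization;
-- labels in different words need the size bounds.
word-isNormDumont : ∀ {n b a} → IsLabelling n b a → IsNormDumont (suc n) (word n b a)
word-isNormDumont {n} {b} {a} lab = record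
  { size = trans (length-weave (a ∷ʳ M) (1 ∷ b) oe) (cong (_* 2) (trans oe (cong suc size-b)))
  ; range = range ∘ pl
  ; once = once⇒ b a size-b size-a once bound
  ; even-below = λ {i} at → even-below i (pl at)
  ; odd-above = λ {i} at → odd-above i (pl at)
  ; normal = λ j 1≤j j< p q → normal j 1≤j (s≤s⁻¹ j<) (pl p) (pl q)
  }
  where
  open IsLabelling lab
  M = suc n * 2
  oe = size-oe b a size-b size-a
  Pl = Place b a size-b size-a
  pl : ∀ {p x} → word n b a [ p ]= x → Pl p x
  pl = place b a size-b size-a

  range : ∀ {p x} → Pl p x → 1 ≤ x × x ≤ M
  range (first _ refl) = s≤s z≤n , s≤s z≤n
  range (final _ refl) = s≤s z≤n , ≤-refl
  range (in-a i _ at) with l , u ← bound (∈-++⁺ʳ b ([]=⇒∈ at)) = ≤-trans (n≤1+n 1) l , ≤-trans u (n≤1+n _)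
  range (in-b i _ at) with l , u ← bound (∈-++⁺ˡ ([]=⇒∈ at)) = ≤-trans (n≤1+n 1) l , ≤-trans u (n≤1+n _)

  even-below : ∀ i {x} → Pl (suc (i * 2)) x → x < suc (suc (i * 2))
  even-below i (first _ refl) = s≤s (s≤s z≤n)
  even-below i (final e _)    = contradiction (sym e) (m*2≢1+n*2 n i)
  even-below i (in-a k e _)   = contradiction (sym e) (m*2≢1+n*2 k i)
  even-below i {x} (in-b k e at)  = subst (λ p → x < suc p) (sym e) (s≤s (proj₂ (bound-b at)))

  odd-above : ∀ i {x} → Pl (i * 2) x → x > suc (i * 2)
  odd-above i (first e _)    = contradiction e (m*2≢1+n*2 i 0)
  odd-above i (final e refl) = subst (λ p → suc p < M) (sym e) ≤-refl
  odd-above i {x} (in-a k e at)  = subst (λ p → suc p < x) (sym e) (proj₁ (bound-a at))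
  odd-above i (in-b k e _)   = contradiction e (m*2≢1+n*2 i (suc k))

  normal : ∀ j → 1 ≤ j → j ≤ n → ∀ {p q} → Pl p (j * 2) → Pl q (suc (j * 2)) → (suc p % 2 ≡ suc q % 2) ⇔ q < p
  normal j 1≤j j≤n (first _ e) _ = contradiction e (m*2≢1+n*2 j 0)
  normal j 1≤j j≤n (final _ e) _ = contradiction (*-cancelʳ-≡ j (suc n) 2 e) (<⇒≢ (s≤s j≤n))
  normal j 1≤j j≤n _ (final _ e) = contradiction (sym e) (m*2≢1+n*2 (suc n) j)
  normal (suc j) 1≤j j≤n _ (first _ ())
  normal j 1≤j j≤n (in-a i refl p) (in-a k refl q) = mk⇔
    (λ _ → *-monoˡ-< 2 (+-cancelˡ-< (length b) k i (ordered j ([]=-++ʳ b p) ([]=-++ʳ b q))))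
    (λ _ → trans (1+i*2%2 i) (sym (1+i*2%2 k)))
  normal j 1≤j j≤n (in-b i refl p) (in-b k refl q) = mk⇔
    (λ _ → +-monoʳ-< 3 (*-monoˡ-< 2 (ordered j ([]=-++ˡ p) ([]=-++ˡ q))))
    (λ _ → trans (2+i*2%2 (suc i)) (sym (2+i*2%2 (suc k))))
  -- Both sides of the equivalence fail: the parities differ, and `mixed-≤` puts `j * 2` before its
  -- partner in σ.
  normal j 1≤j j≤n (in-a i refl p) (in-b k refl q) = mk⇔
    (λ e → contradiction (trans (sym (1+i*2%2 i)) (trans e (2+i*2%2 (suc k)))) λ ())
    (λ lt → contradiction (≤-trans lt (*-monoˡ-≤ 2 i≤k)) (<⇒≱ (s≤s (m≤n+m (k * 2) 3))))
    where
    i≤k : i ≤ k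
    i≤k = mixed-≤ {j = j} (proj₁ (bound-a p)) (n≤1+n _) (n≤1+n _) (proj₂ (bound-b q))
  -- This case cannot arise, since `b` precedes `a` in `b ++ a` and the odd label comes first there.
  normal j 1≤j j≤n (in-b i refl p) (in-a k refl q) =
    contradiction (ordered j ([]=-++ˡ p) ([]=-++ʳ b q))
                  (<⇒≱ (s≤s (≤-trans (<⇒≤ ([]=⇒< p)) (m≤m+n (length b) k))))

-- The Dumont inequalities give one bound on each letter. The sharper lower bound for `b` and upper
-- bound for `a` hold because 1 and 2n+2 are already used up by the two added letters.
word-isLabelling : ∀ {n b a} → length b ≡ n → length a ≡ n →
                   IsNormDumont (suc n) (word n b a) → IsLabelling n b a
word-isLabelling {n} {b} {a} size-b size-a nd = record
  { size-b  = size-b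
  ; size-a  = size-a
  ; bound-b = bound-b
  ; bound-a = bound-a
  ; once    = once⇐ b a size-b size-a once
  ; ordered = ordered
  }
  where
  open IsNormDumont nd
  M = suc n * 2

  1∉ : 1 ∉ b ++ a
  1∉ 1∈ = <⇒≱ (s≤s (≤-trans (mult-∈ 1∈) (m≤n+m _ (ι (1 ≟ M)))))
              (≤-reflexive (trans (sym (mult-word b a size-b size-a 1)) (once 1 ≤-refl (s≤s z≤n))))

  M∉ : M ∉ b ++ a
  M∉ M∈ = <⇒≱ (s≤s (mult-∈ M∈)) (≤-reflexive (begin
    1 + mult M (b ++ a)                          ≡⟨ cong (_+ mult M (b ++ a)) (ι-yes (M ≟ M) refl) ⟨
    ι (M ≟ M) + mult M (b ++ a)                  ≡⟨ mult-word b a size-b size-a M ⟨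
    mult M (word n b a)                          ≡⟨ once M (s≤s z≤n) ≤-refl ⟩
    1                                            ∎))
    where open ≡-Reasoning

  bound-b : ∀ {i x} → b [ i ]= x → 2 ≤ x × x ≤ 3 + i * 2
  bound-b {i} at = ≤∧≢⇒< (proj₁ (range at′)) (λ { refl → 1∉ (∈-++⁺ˡ ([]=⇒∈ at)) }) ,
                   s≤s⁻¹ (even-below {suc i} at′)
    where at′ = word-b b a size-b size-a at

  bound-a : ∀ {i x} → a [ i ]= x → 2 + i * 2 ≤ x × x ≤ 1 + n * 2
  bound-a {i} at = odd-above {i} at′ , s≤s⁻¹ (≤∧≢⇒< (proj₂ (range at′))
                                            (λ { refl → M∉ (∈-++⁺ʳ b ([]=⇒∈ at)) }))
    where at′ = word-a b a size-b size-a at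

  normal′ : ∀ {j p q} → 2 ≤ j * 2 → suc (j * 2) ≤ M → word n b a [ p ]= j * 2 → word n b a [ q ]= suc (j * 2) →
            (suc p % 2 ≡ suc q % 2) ⇔ q < p
  normal′ {j} 2≤ <M = normal j (*-cancelʳ-≤ 1 j 2 2≤) (*-cancelʳ-< 2 j (suc n) <M)

  ordered : Ordered (b ++ a)
  ordered j {s} {t} p q with []=-++⁻ b p | []=-++⁻ b q
  ... | inj₁ p′ | inj₁ q′ = *-cancelʳ-< 2 _ _ (+-cancelˡ-< 3 _ _
      (Equivalence.to (normal′ {j} (proj₁ (bound-b p′)) (proj₂ (range Q)) P Q)
        (trans (2+i*2%2 (suc s)) (sym (2+i*2%2 (suc t))))))
    where
    P = word-b b a size-b size-a p′
    Q = word-b b a size-b size-a q′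
  ... | inj₂ (i , refl , p′) | inj₂ (k , refl , q′) = +-monoʳ-< (length b) (*-cancelʳ-< 2 k i
      (Equivalence.to (normal′ {j} (≤-trans (s≤s (s≤s z≤n)) (proj₁ (bound-a p′))) (proj₂ (range Q)) P Q)
        (trans (1+i*2%2 i) (sym (1+i*2%2 k)))))
    where
    P = word-a b a size-b size-a p′
    Q = word-a b a size-b size-a q′
  ... | inj₂ (i , refl , p′) | inj₁ q′ = ≤-trans ([]=⇒< q′) (m≤m+n (length b) i)
  -- By `mixed-≤` the odd label in `a` precedes the even label in `b` within σ, so the normalization
  -- would force equal parities on an odd and an even position.
  ... | inj₁ p′ | inj₂ (k , refl , q′) = contradiction
      (trans (sym (2+i*2%2 (suc s))) (trans (Equivalence.from (normal′ {j} (proj₁ (bound-b p′))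
         (proj₂ (range Q)) P Q) k<s) (1+i*2%2 k))) λ ()
    where
    P = word-b b a size-b size-a p′
    Q = word-a b a size-b size-a q′
    k<s : k * 2 < 3 + s * 2
    k<s = s≤s (≤-trans (*-monoˡ-≤ 2 (mixed-≤ {k} {s} {j} (proj₁ (bound-a q′)) ≤-refl ≤-refl (proj₂ (bound-b p′))))
                       (m≤n+m (s * 2) 2))

-- The two added letters are forced: σ(2) < 2 leaves only 1, and σ(2n+1) > 2n+1 leaves only 2n+2.
unword : ∀ {n w} → IsNormDumont (suc n) w →
         ∃[ b ] ∃[ a ] length b ≡ n × length a ≡ n × w ≡ word n b a
unword {n} {w} nd with unweave (suc n) w (IsNormDumont.size nd)
... | o , y ∷ b , size-o , size-b , refl with initLast o
...   | a ∷ʳ′ z = b , a , suc-injective size-b , size-a , cong₂ (λ z y → weave (a ∷ʳ z) (y ∷ b)) z≡ y≡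
  where
  open IsNormDumont nd
  size-a : length a ≡ n
  size-a = suc-injective (trans (sym (length-∷ʳ a z)) size-o)
  oe : length (a ∷ʳ z) ≡ length (y ∷ b)
  oe = trans size-o (sym size-b)
  at-y : weave (a ∷ʳ z) (y ∷ b) [ 1 ]= y
  at-y = []=-weaveʳ oe {0} (here refl)
  at-z : weave (a ∷ʳ z) (y ∷ b) [ n * 2 ]= z
  at-z = []=-weaveˡ oe (subst (a ∷ʳ z [_]= z) (trans (+-identityʳ _) size-a) ([]=-++ʳ a (here refl)))
  y≡ : y ≡ 1
  y≡ = ≤-antisym (s≤s⁻¹ (even-below {0} at-y)) (proj₁ (range at-y))
  z≡ : z ≡ suc n * 2
  z≡ = ≤-antisym (proj₂ (range at-z)) (odd-above {n} at-z)

-- The statistic of the constructed permutation.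

module _ {n : ℕ} {b a : List ℕ} (lab : IsLabelling n b a) where
  open IsLabelling lab

  oddPos-word : oddPos (word n b a) ≡ a ∷ʳ suc n * 2
  oddPos-word = oddPos-weave _ _ (size-oe b a size-b size-a)

  evenPos-word : evenPos (word n b a) ≡ 1 ∷ b
  evenPos-word = evenPos-weave (a ∷ʳ suc n * 2) _ (size-oe b a size-b size-a)

  -- The letters below `x` are exactly 2, ..., `x` - 1, each occurring once.
  below-rank : ∀ {x} → x ∈ b ++ a → below x (b ++ a) + 2 ≡ x
  below-rank {x} x∈ with 2≤x , x≤ ← bound x∈ = trans (cong (_+ 2) below≡) (m∸n+n≡m 2≤x)
    where
    below≡ : below x (b ++ a) ≡ x ∸ 2
    below≡ = subst (λ k → below k (b ++ a) ≡ x ∸ 2) (m∸n+n≡m 2≤x)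
      (below-interval 2 (x ∸ 2) (b ++ a) (proj₁ ∘ bound)
        (λ k 2≤k k< → once k 2≤k (≤-trans (<⇒≤ (subst (k <_) (m∸n+n≡m 2≤x) k<)) x≤)))

  cross-b-a : n C 2 + cross b a + n * 2 ≡ sum b
  cross-b-a = begin
    n C 2 + cross b a + n * 2              ≡⟨ cong (λ m → m C 2 + cross b a + m * 2) size-b ⟨
    length b C 2 + cross b a + length b * 2
      ≡⟨ cong (λ c → c + cross b a + length b * 2) (cross-self b distinct-b) ⟨
    cross b b + cross b a + length b * 2   ≡⟨ cong (_+ length b * 2) (cross-++ b b a) ⟨
    cross b (b ++ a) + length b * 2        ≡⟨ cross-ranks b (b ++ a) (below-rank ∘ ∈-++⁺ˡ) ⟩
    sum b                                  ∎
    where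
    open ≡-Reasoning
    distinct-b : ∀ k → mult k b ≤ 1
    distinct-b k = ≤-trans (m≤m+n _ _) (≤-trans (≤-reflexive (sym (tally-++ (k ≟_) b a))) (distinct k))

  -- A least letter in front creates no inversion.
  inv-even : inv (1 ∷ b) ≡ inv b
  inv-even = cong (_+ inv b) (tally-none (_<? 1) b
    (λ x∈ x<1 → <⇒≱ x<1 (≤-trans (n≤1+n 1) (proj₁ (bound (∈-++⁺ˡ x∈))))))

  -- A greatest letter at the end creates no inversion.
  inv-odd : inv (a ∷ʳ suc n * 2) ≡ inv a
  inv-odd = begin
    inv (a ∷ʳ M)                      ≡⟨ inv-++ a [ M ] ⟩
    inv a + 0 + cross a [ M ]         ≡⟨ cong₂ _+_ (+-identityʳ (inv a)) (cross-∷ a M []) ⟩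
    inv a + (tally (M <?_) a + cross a [])
      ≡⟨ cong (inv a +_) (cong₂ _+_ (tally-none (M <?_) a no-above) (cross-[] a)) ⟩
    inv a + 0                         ≡⟨ +-identityʳ (inv a) ⟩
    inv a                             ∎
    where
    open ≡-Reasoning
    M = suc n * 2
    cross-[] : ∀ xs → cross xs [] ≡ 0
    cross-[] []       = refl
    cross-[] (_ ∷ xs) = cross-[] xs
    no-above : ∀ {x} → x ∈ a → ¬ M < x
    no-above x∈ M<x = <⇒≱ M<x (≤-trans (proj₂ (bound (∈-++⁺ʳ b x∈))) (n≤1+n _))

-- Dropping the last of two occurrences leaves each of 1, ..., n exactly once, so counting the
-- entries below n+1 in two ways gives the length.
length-repeats : ∀ {n c} → IsDellac n c → length (repeats c) ≡ n
length-repeats {n} {c} dc = begin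
  length (repeats c)
    ≡⟨ tally-all (_<? n + 1) (repeats c) (λ x∈ → ≤-trans (s≤s (proj₂ (range x∈))) (≤-reflexive (+-comm 1 n))) ⟨
  below (n + 1) (repeats c)
    ≡⟨ below-interval 1 n (repeats c) (proj₁ ∘ range) (λ k 1≤k k< → trans (mult-repeats k c)
         (cong (_∸ 1) (twice k 1≤k (s≤s⁻¹ (≤-trans k< (≤-reflexive (+-comm n 1))))))) ⟩
  n ∎
  where
  open ≡-Reasoning
  open IsDellac dc
  range : ∀ {x} → x ∈ repeats c → 1 ≤ x × x ≤ n
  range x∈ = proj₁ (cell (proj₂ (∈⇒[]= (repeats-⊆ c x∈))))

-- The subtracted terms of the formula are moved across, which keeps the computation in ℕ.
statistics : ∀ {n c b a} → IsDellac n c → IsLabelling n b a → b ++ a ≡ label c →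
             suc n * suc n + inv c ≡ n C 2 + (sum (1 ∷ b) + inv (a ∷ʳ suc n * 2) + inv (1 ∷ b))
statistics {n} {c} {b} {a} dc lab eq = begin
  suc n * suc n + inv c
    -- Of the 2n+1 beyond n², a summand n pays for the inversions that relabelling creates.
    ≡⟨ expand n (inv c) ⟩
  n * n + (inv c + n) + suc n
    ≡⟨ cong₂ (λ p q → p + q + suc n) (sym (nC2-double n)) inversions ⟩
  (n C 2 + n C 2 + n) + (inv b + inv a + cross b a) + suc n
    -- One binomial stays outside; the other joins `cross b a` and 2n to form the sum of `b`, and
    -- the remaining 1 is the first letter of σ^e.
    ≡⟨ regroup (n C 2) n (inv b) (inv a) (cross b a) ⟩
  n C 2 + (suc (n C 2 + cross b a + n * 2) + inv a + inv b)
    ≡⟨ cong (λ m → n C 2 + (suc m + inv a + inv b)) (cross-b-a lab) ⟩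
  n C 2 + (sum (1 ∷ b) + inv a + inv b)
    ≡⟨ cong₂ (λ p q → n C 2 + (sum (1 ∷ b) + p + q)) (inv-odd lab) (inv-even lab) ⟨
  n C 2 + (sum (1 ∷ b) + inv (a ∷ʳ suc n * 2) + inv (1 ∷ b)) ∎
  where
  open ≡-Reasoning
  inversions : inv c + n ≡ inv b + inv a + cross b a
  inversions = begin
    inv c + n                        ≡⟨ cong (inv c +_) (length-repeats dc) ⟨
    inv c + length (repeats c)       ≡⟨ inv-label c ⟨
    inv (label c)                    ≡⟨ cong inv eq ⟨
    inv (b ++ a)                     ≡⟨ inv-++ b a ⟩
    inv b + inv a + cross b a        ∎
  expand : ∀ n i → suc n * suc n + i ≡ n * n + (i + n) + suc n
  expand = solve-∀
  regroup : ∀ c n i j x → (c + c + n) + (i + j + x) + suc n ≡ c + (suc (c + x + n * 2) + j + i)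
  regroup = solve-∀

minus-transport : ∀ A D C B I J → A + D ≡ C + (B + I + J) →
                  ((ℤ.+ A ℤ.- ℤ.+ B) ℤ.- ℤ.+ I) ℤ.- ℤ.+ J ≡ ℤ.+ C ℤ.- ℤ.+ D
minus-transport A D C B I J eq = begin
  ((ℤ.+ A ℤ.- ℤ.+ B) ℤ.- ℤ.+ I) ℤ.- ℤ.+ J          ≡⟨ collect (ℤ.+ A) (ℤ.+ B) (ℤ.+ I) (ℤ.+ J) (ℤ.+ D) ⟩
  -- A sum of nonnegative integers reduces to the image of the sum in ℕ, so `eq` applies directly
  -- under the embedding.
  (ℤ.+ A ℤ.+ ℤ.+ D) ℤ.- (S ℤ.+ ℤ.+ D)              ≡⟨ cong (λ z → z ℤ.- (S ℤ.+ ℤ.+ D)) (cong ℤ.+_ eq) ⟩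
  (ℤ.+ C ℤ.+ S) ℤ.- (S ℤ.+ ℤ.+ D)                  ≡⟨ cancel (ℤ.+ C) S (ℤ.+ D) ⟩
  ℤ.+ C ℤ.- ℤ.+ D                                  ∎
  where
  open ≡-Reasoning
  S = ℤ.+ B ℤ.+ ℤ.+ I ℤ.+ ℤ.+ J
  collect : ∀ a b i j d → ((a ℤ.- b) ℤ.- i) ℤ.- j ≡ (a ℤ.+ d) ℤ.- ((b ℤ.+ i ℤ.+ j) ℤ.+ d)
  collect = ℤ-Solver.solve-∀
  cancel : ∀ c s d → (c ℤ.+ s) ℤ.- (s ℤ.+ d) ≡ c ℤ.- d
  cancel = ℤ-Solver.solve-∀

-- Transfer between vectors and lists.

toList-[]= : ∀ {N} (v : Vec ℕ N) i → toList v [ toℕ i ]= lookup v i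
toList-[]= (x Vec.∷ v) Fin.zero    = here refl
toList-[]= (x Vec.∷ v) (Fin.suc i) = there (toList-[]= v i)

toList-[]=⁻ : ∀ {N} (v : Vec ℕ N) {k x} → toList v [ k ]= x → ∃[ i ] toℕ i ≡ k × lookup v i ≡ x
toList-[]=⁻ (x Vec.∷ v) (here e)   = Fin.zero , refl , e
toList-[]=⁻ (x Vec.∷ v) (there at) with i , refl , e ← toList-[]=⁻ v at = Fin.suc i , refl , e

count-toList : ∀ {N} {P : Pred ℕ 0ℓ} (P? : Decidable P) (v : Vec ℕ N) → count P? v ≡ tally P? (toList v)
count-toList P? Vec.[] = refl
count-toList P? (x Vec.∷ v) with does (P? x)
... | true  = cong suc (count-toList P? v)
... | false = count-toList P? v

toList-injective : ∀ {N} {u v : Vec ℕ N} → toList u ≡ toList v → u ≡ v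
toList-injective {u = u} {v} eq = trans (sym (Vec.cast-is-id refl u)) (Vec.toList-injective refl u v eq)

fromList-sized : ∀ {N} (l : List ℕ) → length l ≡ N → ∃[ v ] toList {n = N} v ≡ l
fromList-sized l refl = fromList l , toList∘fromList l

dellac-toList : ∀ {n} (D : DC n) → IsDellac n (toList (col D))
dellac-toList {n} D = record
  { size  = Vec.length-toList (col D)
  ; cell  = cell′
  ; twice = λ j 1≤j j≤n → trans (sym (count-toList (j ≟_) (col D))) (twoDots D j 1≤j j≤n)
  }
  where
  cell′ : ∀ {i x} → toList (col D) [ i ]= x → (1 ≤ x × x ≤ n) × (x ≤ suc i × suc i ≤ x + n)
  cell′ at with i , refl , refl ← toList-[]=⁻ (col D) at = colRange D i , between D i

dellac-fromList : ∀ {n c} → IsDellac n c → ∃[ D ] toList (col {n} D) ≡ c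
dellac-fromList {n} {c} dc with v , refl ← fromList-sized {2 * n} c (IsDellac.size {n} {c} dc) = record
  { col      = v
  ; colRange = λ i → proj₁ (cell (toList-[]= v i))
  ; between  = λ i → proj₂ (cell (toList-[]= v i))
  ; twoDots  = λ j 1≤j j≤n → trans (count-toList (j ≟_) v) (twice j 1≤j j≤n)
  } , refl
  where open IsDellac dc

normDumont-toList : ∀ {m} (D : NormDumont m) → IsNormDumont m (toList (σ (dumont D)))
normDumont-toList {m} D = record
  { size       = trans (Vec.length-toList v) (*-comm 2 m)
  ; range      = range
  ; once       = λ k 1≤k k≤ → trans (sym (count-toList (k ≟_) v))
                                    (isPerm (dumont D) k 1≤k (subst (k ≤_) (*-comm m 2) k≤))
  ; even-below = λ {i} → even-below {i}
  ; odd-above  = λ {i} → odd-above {i}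
  ; normal     = normal
  }
  where
  v = σ (dumont D)
  range : ∀ {i x} → toList v [ i ]= x → 1 ≤ x × x ≤ m * 2
  range at with i , refl , refl ← toList-[]=⁻ v at =
    subst (λ M → 1 ≤ lookup v i × lookup v i ≤ M) (*-comm 2 m) (valRange (dumont D) i)

  even-below : ∀ {i x} → toList v [ suc (i * 2) ]= x → x < suc (suc (i * 2))
  even-below {i} at with p , p≡ , refl ← toList-[]=⁻ v at =
    subst (λ q → lookup v p < suc q) p≡
      (evenDesc (dumont D) p (trans (cong (λ q → suc q % 2) p≡) (2+i*2%2 i)))

  odd-above : ∀ {i x} → toList v [ i * 2 ]= x → x > suc (i * 2)
  odd-above {i} at with p , p≡ , refl ← toList-[]=⁻ v at =
    subst (λ q → lookup v p > suc q) p≡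
      (oddAsc (dumont D) p (trans (cong (λ q → suc q % 2) p≡) (1+i*2%2 i)))

  normal : ∀ j → 1 ≤ j → j < m → ∀ {p q} → toList v [ p ]= j * 2 → toList v [ q ]= suc (j * 2) →
           (suc p % 2 ≡ suc q % 2) ⇔ q < p
  normal j 1≤j j<m p q with p′ , refl , ep ← toList-[]=⁻ v p | q′ , refl , eq ← toList-[]=⁻ v q =
    normalized D j 1≤j j<m p′ q′ (trans ep (*-comm j 2)) (trans eq (cong suc (*-comm j 2)))

normDumont-fromList : ∀ {m w} → IsNormDumont m w → ∃[ D ] toList (σ (dumont {m} D)) ≡ w
normDumont-fromList {m} {w} nd
  with v , refl ← fromList-sized {2 * m} w (trans (IsNormDumont.size nd) (*-comm m 2)) = record
  { dumont = record
    { σ        = v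
    ; valRange = λ i → subst (λ M → 1 ≤ lookup v i × lookup v i ≤ M) (*-comm m 2) (range (toList-[]= v i))
    ; isPerm   = λ k 1≤k k≤ → trans (count-toList (k ≟_) v) (once k 1≤k (subst (k ≤_) (*-comm 2 m) k≤))
    ; evenDesc = evenDesc′
    ; oddAsc   = oddAsc′
    }
  ; normalized = λ j 1≤j j<m p q ep eq → normal j 1≤j j<m
      (subst (toList v [ _ ]=_) (trans ep (*-comm 2 j)) (toList-[]= v p))
      (subst (toList v [ _ ]=_) (trans eq (cong suc (*-comm 2 j))) (toList-[]= v q))
  } , refl
  where
  open IsNormDumont nd
  evenDesc′ : ∀ i → suc (toℕ i) % 2 ≡ 0 → lookup v i < suc (toℕ i)
  -- Indices start at 0, so an even index is an odd position and contradicts `par`.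
  evenDesc′ i par with toℕ i | toList-[]= v i | even-or-odd (toℕ i)
  ... | p | at | inj₁ e = contradiction (trans (sym (trans (cong (λ q → suc q % 2) e) (1+i*2%2 (half p)))) par) λ ()
  ... | p | at | inj₂ e = subst (λ q → lookup v i < suc q) (sym e)
                            (even-below {half p} (subst (toList v [_]= lookup v i) e at))
  oddAsc′ : ∀ i → suc (toℕ i) % 2 ≡ 1 → lookup v i > suc (toℕ i)
  oddAsc′ i par with toℕ i | toList-[]= v i | even-or-odd (toℕ i)
  ... | p | at | inj₁ e = subst (λ q → lookup v i > suc q) (sym e)
                            (odd-above {half p} (subst (toList v [_]= lookup v i) e at))
  ... | p | at | inj₂ e = contradiction (trans (sym (trans (cong (λ q → suc q % 2) e) (2+i*2%2 (half p)))) par) λ ()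

-- The bijection.

dellacWord : ℕ → List ℕ → List ℕ
dellacWord n c = word n (take n (label c)) (drop n (label c))

dellacWord-label : ∀ {n b a} → length b ≡ n → (eq : label (map half (b ++ a)) ≡ b ++ a) →
                   dellacWord n (map half (b ++ a)) ≡ word n b a
dellacWord-label {n} {b} {a} refl eq rewrite eq = cong₂ (word n) (take-++ b) (drop-++ b)
  where
  take-++ : ∀ xs {ys : List ℕ} → take (length xs) (xs ++ ys) ≡ xs
  take-++ []       = refl
  take-++ (x ∷ xs) = cong (x ∷_) (take-++ xs)
  drop-++ : ∀ xs {ys : List ℕ} → drop (length xs) (xs ++ ys) ≡ ys
  drop-++ []       = refl
  drop-++ (_ ∷ xs) = drop-++ xs

-- The even and odd positions of the word return `b` and `a`; their concatenation is the relabelled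
-- configuration, and halving undoes the relabelling.
dellacWord-injective : ∀ {n c d} → IsDellac n c → IsDellac n d → dellacWord n c ≡ dellacWord n d → c ≡ d
dellacWord-injective {n} {c} {d} dc dd eq = begin
  c                                                       ≡⟨ half-label c ⟨
  map half (label c)                                      ≡⟨ cong (map half) (take++drop≡id n (label c)) ⟨
  map half (take n (label c) ++ drop n (label c))         ≡⟨ cong (map half) (cong₂ _++_ b≡ a≡) ⟩
  map half (take n (label d) ++ drop n (label d))         ≡⟨ cong (map half) (take++drop≡id n (label d)) ⟩
  map half (label d)                                      ≡⟨ half-label d ⟩
  d                                                       ∎
  where
  open ≡-Reasoning
  b≡ : take n (label c) ≡ take n (label d)
  b≡ = ∷-injectiveʳ (trans (sym (evenPos-word (label-isLabelling dc)))
                           (trans (cong evenPos eq) (evenPos-word (label-isLabelling dd))))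
  a≡ : drop n (label c) ≡ drop n (label d)
  a≡ = ∷ʳ-injectiveˡ _ _ (trans (sym (oddPos-word (label-isLabelling dc)))
                                (trans (cong oddPos eq) (oddPos-word (label-isLabelling dd))))

toDumont : ∀ {n} (D : DC n) → ∃[ E ] toList (σ (dumont {suc n} E)) ≡ dellacWord n (toList (col D))
toDumont D = normDumont-fromList (word-isNormDumont (label-isLabelling (dellac-toList D)))

-- The preimage arises by stripping 1 and 2n+2 from σ and halving the remaining letters;
-- `label-half` ensures that relabelling restores them.
toDumont-surjective : ∀ {n} (E : NormDumont (suc n)) →
                      ∃[ D ] dellacWord n (toList (col D)) ≡ toList (σ (dumont E))
toDumont-surjective E
  with b , a , size-b , size-a , w≡ ← unword (normDumont-toList E)
  with lab ← word-isLabelling size-b size-a (subst (IsNormDumont _) w≡ (normDumont-toList E))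
  with D , c≡ ← dellac-fromList (half-isDellac lab) =
  D , trans (cong (dellacWord _) c≡) (trans (dellacWord-label size-b (label-half-labelling lab)) (sym w≡))

st-dellacWord : ∀ {n c} → IsDellac n c → let w = dellacWord n c in
  ((ℤ.+ (suc n * suc n) ℤ.- ℤ.+ sum (evenPos w)) ℤ.- ℤ.+ inv (oddPos w)) ℤ.- ℤ.+ inv (evenPos w)
    ≡ ℤ.+ (n C 2) ℤ.- ℤ.+ inv c
st-dellacWord {n} {c} dc
  rewrite oddPos-word (label-isLabelling dc) | evenPos-word (label-isLabelling dc) =
  minus-transport (suc n * suc n) (inv c) (n C 2) (sum (1 ∷ b)) (inv (a ∷ʳ suc n * 2)) (inv (1 ∷ b))
    (statistics dc (label-isLabelling dc) (take++drop≡id n (label c)))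
  where
  b = take n (label c)
  a = drop n (label c)

st-toDumont : ∀ {n} (D : DC n) → st (dumont (proj₁ (toDumont D))) ≡ ℤ.+ (n C 2) ℤ.- ℤ.+ invDC D
st-toDumont D rewrite proj₂ (toDumont D) = st-dellacWord (dellac-toList D)

open import Data.Integer using (+_; _-_)

theorem5 : ∀ (n : ℕ) → 1 ≤ n →
    Σ (Bijection (DC-setoid n) (NormDumont-setoid (suc n))) λ φ →
    ∀ (D : DC n) → st (dumont (Bijection.to φ D)) ≡ + (n C 2) - + invDC D
theorem5 n _ = record
  { to        = proj₁ ∘ toDumont
  ; cong      = λ {C} {D} eq → toList-injective (trans (proj₂ (toDumont C))
                  (trans (cong (dellacWord n ∘ toList) eq) (sym (proj₂ (toDumont D)))))
  ; bijective =
      (λ {C} {D} eq → toList-injective (dellacWord-injective (dellac-toList C) (dellac-toList D)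
        (trans (sym (proj₂ (toDumont C))) (trans (cong toList eq) (proj₂ (toDumont D))))))
    -- Surjectivity of setoids is required for every `C` with the same array as `D`, hence the extra
    -- congruence.
    , λ E → let D , w≡ = toDumont-surjective E in
        D , λ {C} eq → toList-injective (trans (proj₂ (toDumont C))
              (trans (cong (dellacWord n ∘ toList) eq) w≡))
  } , st-toDumont
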